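{- Let $M=(m_{ij})$ be a non-zero binary matrix of size $n\times m$ with distinct rows $M_{1- },\dots,M_{n- }$. Suppose that for every pair of rows $M_{i- }$ and $M_{j- }$ ($i,j\in\{1,\dots,n\}$, not necessarily distinct) the vector $\neg M_{i- }\lor M_{j- }$ is a row of $M$. Then there exists a column $k\in\{1,\dots,m\}$ of $M$ that contains at least $n/2$ ones, i.e. $\sum_{i=1}^{n} m_{ik}\ge n/2$.
   Context: A binary matrix is a matrix with entries in $\{0,1\}$; it is non-zero if at least one entry equals $1$. $M_{i- }$ denotes the $i$-th row of $M$. The logical operations $\neg$ (negation) and $\lor$ (disjunction) act entrywise on binary vectors, with $1$ as true and $0$ as false. -}

module Defs where

open import Data.Bool using (Bool; true; not; _∨_; if_then_else_)
open import Data.Fin using (Fin)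
open import Data.Nat using (ℕ)
open import Data.Product using (∃₂)
open import Data.Vec using (Vec; lookup; map; zipWith; sum)
open import Relation.Binary.PropositionalEquality using (_≡_)

-- Entries are booleans, with true for 1 and false for 0.  A matrix is the
-- vector of its n rows, each of length m.
BinaryMatrix : ℕ → ℕ → Set
BinaryMatrix n m = Vec (Vec Bool m) n

row : ∀ {n m} → BinaryMatrix n m → Fin n → Vec Bool m
row = lookup

entry : ∀ {n m} → BinaryMatrix n m → Fin n → Fin m → Bool
entry M i k = lookup (row M i) k

IsNonZero : ∀ {n m} → BinaryMatrix n m → Set
IsNonZero M = ∃₂ λ i k → entry M i k ≡ true

infix  8 ¬ᵛ_
infixr 6 _∨ᵛ_

¬ᵛ_ : ∀ {m} → Vec Bool m → Vec Bool m
¬ᵛ_ = map not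

_∨ᵛ_ : ∀ {m} → Vec Bool m → Vec Bool m → Vec Bool m
_∨ᵛ_ = zipWith _∨_

bit : Bool → ℕ
bit b = if b then 1 else 0

columnSum : ∀ {n m} → BinaryMatrix n m → Fin m → ℕ
columnSum M k = sum (map (λ r → bit (lookup r k)) M)

{-# OPTIONS --safe #-}

-- Fix any column k.  Implication-closed families are closed under ∨, since
-- A ∨ B = (A → B) → B, so if some row has a 0 in column k then the
-- disjunction C of all such rows is again a row with a 0 in column k.  The map
-- X ↦ ¬ C ∨ X sends rows with a 0 in column k to rows with a 1 there, and it is
-- injective on them because X ≤ C.  So every column has at least n/2 ones.

module Submission where

open import Defs
open import Data.Nat using (ℕ; _≤_; _*_)
open import Data.Fin using (Fin)
open import Data.Product using (∃-syntax)
open import Data.Vec.Membership.Propositional using (_∈_)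
open import Data.Vec.Relation.Unary.Unique.Propositional using (Unique)

open import Data.Bool using (Bool; true; false; not; _∨_)
open import Data.Fin using (zero; suc)
open import Data.Fin.Properties using (injective⇒≤)
import Data.Fin.Subset as Subset
open Subset using (Subset; _⊆_; _∪_; ∁)
open import Data.Fin.Subset.Properties
  using (_∈?_; ⊆-refl; ⊆-antisym; p⊆p∪q; q⊆p∪q; x∈p∪q⁻; x∈p⇒x∉∁p; x∉p⇒x∈∁p)
open import Data.List as List using (List; []; _∷_; length; filter)
open import Data.List.Membership.Propositional renaming (_∈_ to _∈ₗ_) using ()
open import Data.List.Membership.Propositional.Properties as ∈ₗ
  using (∈-filter⁺; ∈-filter⁻)
open import Data.List.Relation.Unary.All as All using (All; []; _∷_)
open import Data.List.Relation.Unary.AllPairs using ([]; _∷_)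
open import Data.List.Relation.Unary.Any using (index)
open import Data.List.Relation.Unary.Any.Properties using (lookup-index)
import Data.List.Relation.Unary.Unique.Propositional as List
import Data.List.Relation.Unary.Unique.Propositional.Properties as Uniqueₗ
open import Data.Nat using (suc; _+_; z≤n)
open import Data.Nat.Properties
  using (+-suc; +-identityʳ; +-monoʳ-≤; module ≤-Reasoning)
open import Data.Product using (∃; _×_; _,_; proj₁; proj₂)
open import Data.Sum using (inj₁; inj₂; [_,_]′)
open import Data.Vec as Vec using (Vec; []; _∷_; toList)
open import Data.Vec.Membership.Propositional.Properties
  using (∈-toList⁺; ∈-toList⁻)
open import Data.Vec.Properties using ([]=⇒lookup; lookup⇒[]=; length-toList)
open import Data.Vec.Relation.Unary.All.Properties using (toList⁺)
open import Data.Vec.Relation.Unary.AllPairs using ([]; _∷_)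
import Data.Vec.Relation.Unary.Any as Any
import Data.Vec.Relation.Unary.Any.Properties as Any
open import Function using (_∘_)
open import Level using (Level)
open import Relation.Binary.PropositionalEquality
  using (_≡_; refl; sym; trans; cong; cong₂; subst; subst₂)
open import Relation.Nullary using (¬_; ¬?; yes; no; contradiction)
open import Relation.Unary using (Pred; Decidable)

private
  variable
    a p ℓ : Level
    A B : Set a
    m n : ℕ

toList-unique : {xs : Vec A n} → Unique xs → List.Unique (toList xs)
toList-unique []         = []
toList-unique (x∉xs ∷ u) = toList⁺ x∉xs ∷ toList-unique u

lookup-injectiveₗ : {xs : List A} → List.Unique xs →
  ∀ {i j} → List.lookup xs i ≡ List.lookup xs j → i ≡ j
lookup-injectiveₗ (_ ∷ _)    {zero}  {zero}  _  = refl
lookup-injectiveₗ (x∉xs ∷ _) {zero}  {suc j} eq =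
  contradiction eq (All.lookup x∉xs (∈ₗ.∈-lookup j))
lookup-injectiveₗ (x∉xs ∷ _) {suc i} {zero}  eq =
  contradiction (sym eq) (All.lookup x∉xs (∈ₗ.∈-lookup i))
lookup-injectiveₗ (_ ∷ u)    {suc i} {suc j} eq = cong suc (lookup-injectiveₗ u eq)

-- Sending an index of `xs` to the position of its image in `ys` gives an injection between finite
-- ordinals. Injectivity is asked only on members of `xs`, since the map used later, `∁ c ∪_`, is
-- injective only on subsets of `c`.
injectiveOn⇒length≤ : {xs : List A} {ys : List B} (f : A → B) → List.Unique xs →
  (∀ {x} → x ∈ₗ xs → f x ∈ₗ ys) →
  (∀ {x y} → x ∈ₗ xs → y ∈ₗ xs → f x ≡ f y → x ≡ y) →
  length xs ≤ length ys
injectiveOn⇒length≤ {xs = xs} {ys} f u f∈ f-inj =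
  injective⇒≤ {f = position} λ {i} {j} eq →
    lookup-injectiveₗ u (f-inj (∈ₗ.∈-lookup i) (∈ₗ.∈-lookup j)
      (trans (lookup-index (f∈ (∈ₗ.∈-lookup i)))
        (trans (cong (List.lookup ys) eq) (sym (lookup-index (f∈ (∈ₗ.∈-lookup j)))))))
  where
  position : Fin (length xs) → Fin (length ys)
  position i = index (f∈ (∈ₗ.∈-lookup i))

length-filter-¬ : {P : Pred A p} (P? : Decidable P) (xs : List A) →
  length (filter P? xs) + length (filter (¬? ∘ P?) xs) ≡ length xs
length-filter-¬ P? []       = refl
length-filter-¬ P? (x ∷ xs) with P? x
... | yes _ = cong suc (length-filter-¬ P? xs)
... | no  _ = trans (+-suc _ _) (cong suc (length-filter-¬ P? xs))

∪-via-implication : (p q : Subset m) → ∁ (∁ p ∪ q) ∪ q ≡ p ∪ q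
∪-via-implication []      []      = refl
∪-via-implication (x ∷ p) (y ∷ q) = cong₂ _∷_ (head x y) (∪-via-implication p q)
  where
  head : (x y : Bool) → not (not x ∨ y) ∨ y ≡ x ∨ y
  head true  true  = refl
  head true  false = refl
  head false true  = refl
  head false false = refl

-- A member of `p` lies in `c`, hence not in `∁ c`, so in `∁ c ∪ q` it can only come from `q`. Used
-- in both directions, this recovers a subset of `c` from its image.
implication-cancelˡ-⊆ : (p q c : Subset m) → p ⊆ c → ∁ c ∪ p ≡ ∁ c ∪ q → p ⊆ q
implication-cancelˡ-⊆ p q c p⊆c eq {x} x∈p
  with x∈p∪q⁻ (∁ c) q (subst (x Subset.∈_) eq (q⊆p∪q (∁ c) p x∈p))
... | inj₁ x∈∁c = contradiction x∈∁c (x∈p⇒x∉∁p (p⊆c x∈p))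
... | inj₂ x∈q  = x∈q

-- The bound is the union of the whole list. The list must be nonempty because `P` is not assumed to
-- hold of the empty set.
∪-closed⇒upperBound : {P : Pred (Subset m) ℓ} →
  (∀ {p q} → P p → P q → P (p ∪ q)) →
  ∀ {p ps} → All P (p ∷ ps) → ∃ λ c → P c × All (_⊆ c) (p ∷ ps)
∪-closed⇒upperBound ∪-closed {p} {[]}     (Pp ∷ []) = p , Pp , ⊆-refl ∷ []
∪-closed⇒upperBound ∪-closed {p} {_ ∷ _} (Pp ∷ Pps)
  with c , Pc , ps⊆c ← ∪-closed⇒upperBound ∪-closed Pps =
  p ∪ c , ∪-closed Pp Pc , p⊆p∪q c ∷
    All.map {P = _⊆ c} {Q = _⊆ p ∪ c} (λ q⊆c → q⊆p∪q p c ∘ q⊆c) ps⊆c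

columnSum≡length-filter : (M : BinaryMatrix n m) (k : Fin m) →
  columnSum M k ≡ length (filter (k ∈?_) (toList M))
columnSum≡length-filter []      k = refl
-- The filter branches on membership and the sum on the bit, so both are split; the two mixed cases
-- are contradictory.
columnSum≡length-filter (r ∷ M) k with k ∈? r | Vec.lookup r k in eq
... | yes _   | true  = cong suc (columnSum≡length-filter M k)
... | no _    | false = columnSum≡length-filter M k
... | yes k∈r | false = contradiction (trans (sym ([]=⇒lookup k∈r)) eq) λ ()
... | no k∉r  | true  = contradiction (lookup⇒[]= k r eq) k∉r

module _ (M : BinaryMatrix n m)
         (closed : ∀ {r s} → r ∈ M → s ∈ M → ¬ᵛ r ∨ᵛ s ∈ M) where

  ∪-closed : ∀ {r s} → r ∈ M → s ∈ M → r ∪ s ∈ M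
  ∪-closed {r} {s} r∈M s∈M =
    -- A row is read as the set of columns where it has a one; `¬ᵛ_` and `_∨ᵛ_` then agree by
    -- definition with `∁` and `_∪_`.
    subst (_∈ M) (∪-via-implication r s) (closed (closed r∈M s∈M) s∈M)

  zeros≤ones : Unique M → ∀ k →
    length (filter (¬? ∘ (k ∈?_)) (toList M)) ≤ length (filter (k ∈?_) (toList M))
  zeros≤ones M! k = bound (filter ∉? (toList M)) (Uniqueₗ.filter⁺ ∉? (toList-unique M!))
    (All.tabulate λ r∈ → let r∈M , k∉r = ∈-filter⁻ ∉? r∈ in ∈-toList⁻ r∈M , k∉r)
    where
    ∉? : Decidable (λ r → ¬ (k Subset.∈ r))
    ∉? r = ¬? (k ∈? r)

    Zero : Pred (Subset m) _
    Zero r = r ∈ M × ¬ (k Subset.∈ r)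

    -- Generalised from the filtered list to any `rs` so that the empty case, where there is no `c`
    -- to choose, can be split off.
    bound : ∀ rs → List.Unique rs → All Zero rs →
      length rs ≤ length (filter (k ∈?_) (toList M))
    bound []         _  _      = z≤n
    bound rs@(_ ∷ _) u zeros
      -- `Zero` is closed under unions, because a union contains `k` only if one of its parts does;
      -- so the bound `c` is itself a row with a zero at `k`.
      with c , (c∈M , k∉c) , rs⊆c ← ∪-closed⇒upperBound {P = Zero}
             (λ {p} {q} (p∈M , k∉p) (q∈M , k∉q) →
               ∪-closed p∈M q∈M , [ k∉p , k∉q ]′ ∘ x∈p∪q⁻ p q)
             zeros =
      injectiveOn⇒length≤ (∁ c ∪_) u
        (λ {r} r∈ → ∈-filter⁺ (k ∈?_)
          (∈-toList⁺ (closed c∈M (proj₁ (All.lookup zeros r∈))))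
          -- The one at `k` in the image comes from `∁ c`, as `c` misses `k`.
          (p⊆p∪q r (x∉p⇒x∈∁p k∉c)))
        (λ {r} {s} r∈ s∈ eq → ⊆-antisym
          (implication-cancelˡ-⊆ r s c (All.lookup rs⊆c r∈) eq)
          (implication-cancelˡ-⊆ s r c (All.lookup rs⊆c s∈) (sym eq)))

  n≤2*columnSum : Unique M → ∀ k → n ≤ 2 * columnSum M k
  n≤2*columnSum M! k = begin
    n                     ≡⟨ length-toList M ⟨
    length (toList M)     ≡⟨ length-filter-¬ (k ∈?_) (toList M) ⟨
    ones + zeros          ≤⟨ +-monoʳ-≤ ones (zeros≤ones M! k) ⟩
    ones + ones           ≡⟨ cong (ones +_) (+-identityʳ ones) ⟨
    2 * ones              ≡⟨ cong (2 *_) (columnSum≡length-filter M k) ⟨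
    2 * columnSum M k     ∎
    where
    open ≤-Reasoning
    ones  = length (filter (k ∈?_) (toList M))
    zeros = length (filter (¬? ∘ (k ∈?_)) (toList M))

theorem1p1 : ∀ (n m : ℕ) (M : BinaryMatrix n m) →
    IsNonZero M →
    Unique M →
    (∀ (i j : Fin n) → (¬ᵛ row M i ∨ᵛ row M j) ∈ M) →
    ∃[ k ] n ≤ 2 * columnSum M k
-- The non-zero entry guarantees that a column exists, and its column is the witness.
theorem1p1 n m M (_ , k , _) M! closed = k , n≤2*columnSum M closed′ M! k
  where
  closed′ : ∀ {r s} → r ∈ M → s ∈ M → ¬ᵛ r ∨ᵛ s ∈ M
  -- Each member of `M` is rewritten as the row at its index, where the indexed closure hypothesis
  -- applies.
  closed′ r∈M s∈M = subst₂ (λ r s → ¬ᵛ r ∨ᵛ s ∈ M)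
    (sym (Any.lookup-index r∈M)) (sym (Any.lookup-index s∈M))
    (closed (Any.index r∈M) (Any.index s∈M))
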